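{- Let $G$ and $H$ be nontrivial connected graphs. The disjunctive product $G \vee H$ is well-dominated if and only if at least one of $G$ or $H$ is a complete graph and the other factor is well-dominated with domination number at most $2$.
   Context: All graphs are finite and simple. A graph is nontrivial if it has at least $2$ vertices. A set $D\subseteq V(G)$ is a dominating set of $G$ if every vertex of $G$ is in $D$ or adjacent to a vertex of $D$. The domination number $\gamma(G)$ is the minimum cardinality of a dominating set. A graph is well-dominated if all of its minimal (with respect to inclusion) dominating sets have the same cardinality. The disjunctive product $G\vee H$ has vertex set $V(G)\times V(H)$, and distinct vertices $(g_1,h_1)$, $(g_2,h_2)$ are adjacent iff $g_1g_2\in E(G)$ or $h_1h_2\in E(H)$. -}

module Defs where

open import Data.Fin using (Fin)
open import Data.Fin.Properties using (*↔×; all?; any?)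
open import Data.Fin.Subset using (Subset; ∣_∣; ⊤; _⊂_) renaming (_∈_ to _∈ₛ_)
open import Data.Fin.Subset.Properties using (anySubset?; ∈⊤) renaming (_∈?_ to _∈ₛ?_)
open import Data.Nat using (ℕ; zero; suc; _≤_; _*_; z≤n; s≤s; _≟_)
open import Data.Product using (∃; ∃-syntax; _×_; _,_; proj₁; proj₂)
open import Data.Product.Function.NonDependent.Propositional using (_×-↔_)
open import Data.Sum using (_⊎_; inj₁; inj₂) renaming (map to ⊎-map)
open import Function using (_∘_; _↔_; Inverse)
open import Function.Construct.Composition using (_↔-∘_)
open import Function.Construct.Symmetry using (↔-sym)
open import Level using (0ℓ)
open import Relation.Binary.Construct.Closure.ReflexiveTransitive using (Star)
open import Relation.Binary.Core using (Rel)
open import Relation.Binary.Definitions using (Symmetric; Irreflexive; Decidable)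
open import Relation.Binary.PropositionalEquality using (_≡_; _≢_; refl; sym; subst)
open import Relation.Nullary using (¬_; yes; no; contradiction)
open import Relation.Nullary.Decidable using (map′; _×-dec_; _⊎-dec_)
open import Relation.Unary using (Pred) renaming (Decidable to Decidable₁)

-- Finite simple graphs: finiteness is an explicit enumeration of the vertices,
-- and adjacency is decidable.
record Graph : Set₁ where
  field
    V         : Set
    order     : ℕ
    enum      : V ↔ Fin order
    Adj       : Rel V 0ℓ
    Adj?      : Decidable Adj
    symmetric : Symmetric Adj
    loopless  : Irreflexive _≡_ Adj

  index : V → Fin order
  index = Inverse.to enum

  vertex : Fin order → V
  vertex = Inverse.from enum

  index-vertex : ∀ i → index (vertex i) ≡ i
  index-vertex = Inverse.strictlyInverseˡ enum

  vertex-index : ∀ v → vertex (index v) ≡ v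
  vertex-index = Inverse.strictlyInverseʳ enum

  -- Sets of vertices are subsets of the index set, so that the library's
  -- cardinality ∣_∣ and strict inclusion _⊂_ apply to them.
  VSet : Set
  VSet = Subset order

  infix 4 _∈_
  _∈_ : V → VSet → Set
  v ∈ D = index v ∈ₛ D

  Nontrivial : Set
  Nontrivial = 2 ≤ order

  Connected : Set
  Connected = ∀ u v → Star Adj u v

  Complete : Set
  Complete = ∀ {u v} → u ≢ v → Adj u v

  Dominating : VSet → Set
  Dominating D = ∀ v → v ∈ D ⊎ (∃[ u ] (u ∈ D × Adj v u))

  MinimalDominating : VSet → Set
  MinimalDominating D = Dominating D × (∀ D′ → D′ ⊂ D → ¬ Dominating D′)

  WellDominated : Set
  WellDominated = ∀ D D′ → MinimalDominating D → MinimalDominating D′ → ∣ D ∣ ≡ ∣ D′ ∣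

IsMinimum : Pred ℕ 0ℓ → Pred ℕ 0ℓ
IsMinimum P k = P k × (∀ j → P j → k ≤ j)

minimum : ∀ {P} → Decidable₁ P → ∃ P → ∃ (IsMinimum P)
minimum {P} P? (n , p) = go P P? n p
  where
  go : ∀ P → Decidable₁ P → ∀ n → P n → ∃ (IsMinimum P)
  go P P? zero    p = zero , p , λ _ _ → z≤n
  go P P? (suc n) p with P? zero
  ... | yes p₀ = zero , p₀ , λ _ _ → z≤n
  ... | no ¬p₀ with go (P ∘ suc) (P? ∘ suc) n p
  ...   | k , q , least = suc k , q , λ where
          zero    p₀ → contradiction p₀ ¬p₀
          (suc j) pⱼ → s≤s (least j pⱼ)

module _ (G : Graph) where
  open Graph G

  dominating? : Decidable₁ Dominating
  dominating? D = map′
    (λ f v → subst Dominated (vertex-index v) (f (index v)))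
    (λ f i → f (vertex i))
    (all? (λ i → dominated? (vertex i)))
    where
    Dominated : V → Set
    Dominated v = v ∈ D ⊎ (∃[ u ] (u ∈ D × Adj v u))

    dominated? : Decidable₁ Dominated
    dominated? v = (index v ∈ₛ? D) ⊎-dec map′
      (λ (i , q) → vertex i , q)
      (λ (u , q) → index u , subst (λ w → w ∈ D × Adj v w) (sym (vertex-index u)) q)
      (any? (λ i → (index (vertex i) ∈ₛ? D) ×-dec Adj? v (vertex i)))

  DominatingSetOfSize : Pred ℕ 0ℓ
  DominatingSetOfSize k = ∃[ D ] (Dominating D × ∣ D ∣ ≡ k)

  minimumDominating : ∃ (IsMinimum DominatingSetOfSize)
  minimumDominating = minimum
    (λ k → anySubset? (λ D → dominating? D ×-dec (∣ D ∣ ≟ k)))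
    (∣ ⊤ {order} ∣ , ⊤ , (λ _ → inj₁ ∈⊤) , refl)

  γ : ℕ
  γ = proj₁ minimumDominating

  γ-isMinimum : IsMinimum DominatingSetOfSize γ
  γ-isMinimum = proj₂ minimumDominating

open Graph public using (Nontrivial; Connected; Complete; WellDominated)

infixr 6 _∨_

-- Distinctness of adjacent vertices need not be required separately: it follows
-- from both factors being loopless.
_∨_ : Graph → Graph → Graph
G ∨ H = record
  { V         = G.V × H.V
  ; order     = G.order * H.order
  ; enum      = ↔-sym *↔× ↔-∘ (G.enum ×-↔ H.enum)
  ; Adj       = λ (g₁ , h₁) (g₂ , h₂) → G.Adj g₁ g₂ ⊎ H.Adj h₁ h₂
  ; Adj?      = λ (g₁ , h₁) (g₂ , h₂) → G.Adj? g₁ g₂ ⊎-dec H.Adj? h₁ h₂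
  ; symmetric = ⊎-map G.symmetric H.symmetric
  ; loopless  = λ where
      refl (inj₁ gg) → G.loopless refl gg
      refl (inj₂ hh) → H.loopless refl hh
  }
  where
  module G = Graph G
  module H = Graph H

{-# OPTIONS --safe #-}

-- If A and B are maximal independent sets of G and H, then A × B is maximal
-- independent in G ∨ H, hence a minimal dominating set.  If T totally dominates
-- H, then {g} × T dominates G ∨ H.  When H is connected and not complete it has
-- an induced path x – y – z; choosing B ∋ x, z and adding to B a neighbour of
-- each of its members, with y shared by x and z, gives T with ∣T∣ < 2∣B∣.  When
-- moreover G is not complete, some A has at least two elements, so
-- ∣{g} × T∣ < ∣A × B∣ and G ∨ H is not well-dominated.
--
-- When G is complete, the minimal dominating sets inside a row {g} × V(H) are
-- those of H, and any two vertices in different rows dominate G ∨ H.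

module Submission where

open import Defs
open import Data.Fin using (Fin; zero; suc)
import Data.Fin.Properties as Fin
open import Data.Fin.Subset using (Subset; ⊤; ∣_∣; _⊂_; _⊆_; inside; outside) renaming (_∈_ to _∈ₛ_)
open import Data.Fin.Subset.Induction using (Acc; acc; ⊂-wellFounded; ⊃-wellFounded)
open import Data.Fin.Subset.Properties using (anySubset?; _⊂?_; ⊆-trans; ∈⊤) renaming (_∈?_ to _∈ₛ?_)
open import Data.List using (List; []; _∷_; [_]; _++_; map; filter; length; cartesianProduct)
import Data.List.Membership.DecPropositional as DecMembership
open import Data.List.Membership.Propositional using () renaming (_∈_ to _∈ˡ_)
open import Data.List.Membership.Propositional.Properties
  using (∈-map⁺; ∈-map⁻; ∈-filter⁺; ∈-++⁺ˡ; ∈-++⁺ʳ; ∈-cartesianProduct⁺; ∈-cartesianProduct⁻)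
open import Data.List.Properties using (length-map; length-++; filter-notAll)
open import Data.List.Relation.Unary.All using ([]; _∷_)
import Data.List.Relation.Unary.All as All
import Data.List.Relation.Unary.All.Properties as All
open import Data.List.Relation.Unary.AllPairs using ([]; _∷_)
open import Data.List.Relation.Unary.Any using (here; there)
import Data.List.Relation.Unary.Any as Any
open import Data.List.Relation.Unary.Unique.Propositional using (Unique)
import Data.List.Relation.Unary.Unique.Propositional.Properties as Unique
open import Data.Nat using (ℕ; _≤_; _<_; _+_; _*_; z≤n; s≤s; _≤?_)
open import Data.Nat.Properties
  using (≤-antisym; ≤-trans; <⇒≱; +-monoʳ-<; +-identityʳ; *-monoˡ-≤; module ≤-Reasoning)
open import Data.Product using (∃; ∃₂; ∃-syntax; _×_; _,_; proj₁; proj₂; swap)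
open import Data.Sum using (_⊎_; inj₁; inj₂)
import Data.Sum as Sum
open import Data.Vec using ([]; _∷_; tabulate; here; there)
open import Data.Vec.Properties using (lookup∘tabulate; lookup⇒[]=; []=⇒lookup)
open import Function using (_∘_; id; case_of_)
open import Function.Bundles using (_⇔_; mk⇔)
open import Function.Properties.Inverse using (↔⇒↣)
open import Level using (0ℓ)
open import Relation.Binary.Construct.Closure.ReflexiveTransitive using (Star; ε; _◅_)
open import Relation.Binary.Definitions using (DecidableEquality)
open import Relation.Binary.PropositionalEquality
  using (_≡_; _≢_; refl; sym; trans; cong; cong₂; subst; module ≡-Reasoning)
open import Relation.Nullary using (¬_; Dec; yes; no; does; proof; contradiction; ¬?; Reflects; invert)
open import Relation.Nullary.Decidable using (map′; _×-dec_; _⊎-dec_; via-injection; dec-true; decidable-stable)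
open import Relation.Unary using (Pred; Decidable)

-- Counting elements of lists and subsets.

-- Deleting the head `x` from `ys` shortens `ys` and, since `x` does not recur in `xs`, keeps every
-- element of the tail.
Unique-⊆⇒length≤ : ∀ {A : Set} → DecidableEquality A → ∀ {xs ys : List A} →
  Unique xs → (∀ {x} → x ∈ˡ xs → x ∈ˡ ys) → length xs ≤ length ys
Unique-⊆⇒length≤ _≟_ [] _ = z≤n
Unique-⊆⇒length≤ _≟_ {x ∷ xs} {ys} (x∉xs ∷ uxs) xs⊆ys = ≤-trans
  (s≤s (Unique-⊆⇒length≤ _≟_ uxs λ y∈xs →
    ∈-filter⁺ (λ y → ¬? (x ≟ y)) (xs⊆ys (there y∈xs)) (All.lookup x∉xs y∈xs)))
  (filter-notAll (λ y → ¬? (x ≟ y)) ys (Any.map (λ x≡y x≢y → x≢y x≡y) (xs⊆ys (here refl))))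

length-cartesianProduct : ∀ {A B : Set} (xs : List A) (ys : List B) →
  length (cartesianProduct xs ys) ≡ length xs * length ys
length-cartesianProduct []       ys = refl
length-cartesianProduct (x ∷ xs) ys = trans (length-++ (map (x ,_) ys))
  (cong₂ _+_ (length-map (x ,_) ys) (length-cartesianProduct xs ys))

toList : ∀ {n} → Subset n → List (Fin n)
toList []            = []
toList (inside  ∷ p) = zero ∷ map suc (toList p)
toList (outside ∷ p) = map suc (toList p)

length-toList : ∀ {n} (p : Subset n) → length (toList p) ≡ ∣ p ∣
length-toList []            = refl
length-toList (inside  ∷ p) = cong ℕ.suc (trans (length-map suc (toList p)) (length-toList p))
length-toList (outside ∷ p) = trans (length-map suc (toList p)) (length-toList p)

toList-unique : ∀ {n} (p : Subset n) → Unique (toList p)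
toList-unique []            = []
toList-unique (inside  ∷ p) =
  All.map⁺ (All.universal (λ _ ()) (toList p)) ∷ Unique.map⁺ Fin.suc-injective (toList-unique p)
toList-unique (outside ∷ p) = Unique.map⁺ Fin.suc-injective (toList-unique p)

∈-toList⁺ : ∀ {n} {p : Subset n} {i} → i ∈ₛ p → i ∈ˡ toList p
∈-toList⁺                    here        = here refl
∈-toList⁺ {p = inside  ∷ _} (there i∈p) = there (∈-map⁺ suc (∈-toList⁺ i∈p))
∈-toList⁺ {p = outside ∷ _} (there i∈p) = ∈-map⁺ suc (∈-toList⁺ i∈p)

∈-toList⁻ : ∀ {n} (p : Subset n) {i} → i ∈ˡ toList p → i ∈ₛ p
∈-toList⁻ (inside  ∷ p) (here refl) = here
∈-toList⁻ (inside  ∷ p) (there i∈)  with _ , j∈ , refl ← ∈-map⁻ suc i∈ = there (∈-toList⁻ p j∈)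
∈-toList⁻ (outside ∷ p) i∈          with _ , j∈ , refl ← ∈-map⁻ suc i∈ = there (∈-toList⁻ p j∈)

distinctIndices : ∀ {n} → 2 ≤ n → ∃₂ λ (i j : Fin n) → i ≢ j
distinctIndices (s≤s (s≤s _)) = zero , suc zero , λ ()

-- Vertex sets and the lists of their elements.

module Vertices (G : Graph) where
  open Graph G public hiding (Nontrivial; Connected; Complete; WellDominated)

  infix 4 _≟_ _∈?_

  _≟_ : DecidableEquality V
  _≟_ = via-injection (↔⇒↣ enum) Fin._≟_

  open DecMembership _≟_ public using () renaming (_∈?_ to _∈ˡ?_)

  _∈?_ : ∀ v D → Dec (v ∈ D)
  v ∈? D = index v ∈ₛ? D

  any? : ∀ {P : Pred V 0ℓ} → Decidable P → Dec (∃ P)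
  any? {P} P? = map′
    (λ (i , p) → vertex i , p)
    (λ (v , p) → index v , subst P (sym (vertex-index v)) p)
    (Fin.any? (λ i → P? (vertex i)))

  vertex-injective : ∀ {i j} → vertex i ≡ vertex j → i ≡ j
  vertex-injective {i} {j} eq = trans (sym (index-vertex i)) (trans (cong index eq) (index-vertex j))

  ⊆⁺ : ∀ {D E} → (∀ {v} → v ∈ D → v ∈ E) → D ⊆ E
  ⊆⁺ {D} {E} D⊆E {i} i∈D = subst (_∈ₛ E) (index-vertex i) (D⊆E (subst (_∈ₛ D) (sym (index-vertex i)) i∈D))

  ⊂⁺ : ∀ {D E v} → (∀ {v} → v ∈ D → v ∈ E) → v ∈ E → ¬ v ∈ D → D ⊂ E
  ⊂⁺ D⊆E v∈E v∉D = ⊆⁺ D⊆E , _ , v∈E , v∉D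

  ⊂⁻ : ∀ {D E} → D ⊂ E → ∃[ v ] (v ∈ E × ¬ v ∈ D)
  ⊂⁻ {D} {E} (_ , i , i∈E , i∉D) =
    vertex i , subst (_∈ₛ E) (sym (index-vertex i)) i∈E , i∉D ∘ subst (_∈ₛ D) (index-vertex i)

  ⟦_⟧ : ∀ {P : Pred V 0ℓ} → Decidable P → VSet
  ⟦ P? ⟧ = tabulate (does ∘ P? ∘ vertex)

  module _ {P : Pred V 0ℓ} (P? : Decidable P) where

    ∈⟦⟧⁺ : ∀ {v} → P v → v ∈ ⟦ P? ⟧
    ∈⟦⟧⁺ {v} p = lookup⇒[]= (index v) _ (trans (lookup∘tabulate _ (index v))
      (dec-true (P? _) (subst P (sym (vertex-index v)) p)))

    ∈⟦⟧⁻ : ∀ {v} → v ∈ ⟦ P? ⟧ → P v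
    ∈⟦⟧⁻ {v} v∈ = subst P (vertex-index v) (invert (subst (Reflects _)
      (trans (sym (lookup∘tabulate _ (index v))) ([]=⇒lookup v∈))
      (proof (P? (vertex (index v))))))

  elements : VSet → List V
  elements D = map vertex (toList D)

  length-elements : ∀ D → length (elements D) ≡ ∣ D ∣
  length-elements D = trans (length-map vertex (toList D)) (length-toList D)

  elements-unique : ∀ D → Unique (elements D)
  elements-unique D = Unique.map⁺ vertex-injective (toList-unique D)

  ∈-elements⁺ : ∀ {D v} → v ∈ D → v ∈ˡ elements D
  ∈-elements⁺ {D} {v} v∈D = subst (_∈ˡ elements D) (vertex-index v) (∈-map⁺ vertex (∈-toList⁺ v∈D))

  ∈-elements⁻ : ∀ {D v} → v ∈ˡ elements D → v ∈ D
  ∈-elements⁻ {D} v∈ with i , i∈ , refl ← ∈-map⁻ vertex v∈ =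
    subst (_∈ₛ D) (sym (index-vertex i)) (∈-toList⁻ D i∈)

  ∣∣≤length : ∀ {D xs} → (∀ {v} → v ∈ D → v ∈ˡ xs) → ∣ D ∣ ≤ length xs
  ∣∣≤length {D} D⊆xs = subst (_≤ _) (length-elements D)
    (Unique-⊆⇒length≤ _≟_ (elements-unique D) (D⊆xs ∘ ∈-elements⁻))

  length≤∣∣ : ∀ {D xs} → Unique xs → (∀ {v} → v ∈ˡ xs → v ∈ D) → length xs ≤ ∣ D ∣
  length≤∣∣ {D} uxs xs⊆D = subst (_ ≤_) (length-elements D)
    (Unique-⊆⇒length≤ _≟_ uxs (∈-elements⁺ ∘ xs⊆D))

  ⊆⇒∣∣≤ : ∀ {D E} → (∀ {v} → v ∈ D → v ∈ E) → ∣ D ∣ ≤ ∣ E ∣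
  ⊆⇒∣∣≤ {E = E} D⊆E = subst (_ ≤_) (length-elements E) (∣∣≤length (∈-elements⁺ ∘ D⊆E))

  opaque
    -- Kept opaque so that it never unfolds to a tabulation; only the two membership lemmas below
    -- see its body.
    setOf : List V → VSet
    setOf xs = ⟦ _∈ˡ? xs ⟧

    ∈-setOf⁺ : ∀ {xs v} → v ∈ˡ xs → v ∈ setOf xs
    ∈-setOf⁺ {xs} = ∈⟦⟧⁺ (_∈ˡ? xs)

    ∈-setOf⁻ : ∀ {xs v} → v ∈ setOf xs → v ∈ˡ xs
    ∈-setOf⁻ {xs} = ∈⟦⟧⁻ (_∈ˡ? xs)

  ∣setOf∣≡length : ∀ {xs} → Unique xs → ∣ setOf xs ∣ ≡ length xs
  ∣setOf∣≡length uxs = ≤-antisym (∣∣≤length ∈-setOf⁻) (length≤∣∣ uxs ∈-setOf⁺)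

  distinct⇒2≤∣∣ : ∀ {D u v} → u ≢ v → u ∈ D → v ∈ D → 2 ≤ ∣ D ∣
  distinct⇒2≤∣∣ u≢v u∈D v∈D = length≤∣∣ ((u≢v ∷ []) ∷ [] ∷ []) λ where
    (here refl)         → u∈D
    (there (here refl)) → v∈D

  -- Minimal dominating sets and maximal independent sets.

  member : ∀ {D} → V → Dominating D → ∃[ v ] v ∈ D
  member v dom = Sum.[ (v ,_) , (λ (u , u∈D , _) → u , u∈D) ]′ (dom v)

  -- Descent along strict inclusion: as long as a strictly smaller dominating set exists, the search
  -- finds one and continues from it.
  minimal⊆ : ∀ {D} → Dominating D → ∃[ M ] ((∀ {v} → v ∈ M → v ∈ D) × MinimalDominating M)
  minimal⊆ {D} dom = let M , M⊆D , min = go D (⊂-wellFounded D) dom in M , (λ v∈M → M⊆D v∈M) , min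
    where
    go : ∀ D → Acc _⊂_ D → Dominating D → ∃[ M ] (M ⊆ D × MinimalDominating M)
    go D (acc rec) dom with anySubset? (λ E → (E ⊂? D) ×-dec dominating? G E)
    ... | no ∄ = D , id , dom , λ E E⊂D domE → ∄ (E , E⊂D , domE)
    ... | yes (E , E⊂D , domE) with M , M⊆E , min ← go E (rec E⊂D) domE =
      M , ⊆-trans M⊆E (proj₁ E⊂D) , min

  dominated? : ∀ D v → Dec (v ∈ D ⊎ (∃[ u ] (u ∈ D × Adj v u)))
  dominated? D v = (v ∈? D) ⊎-dec any? (λ u → (u ∈? D) ×-dec Adj? v u)

  Independent : VSet → Set
  Independent D = ∀ {u v} → u ∈ D → v ∈ D → ¬ Adj u v

  -- A vertex of `D` missing from `E` would need a neighbour in `E`, hence in `D`.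
  independent⇒minimal : ∀ {D} → Independent D → Dominating D → MinimalDominating D
  independent⇒minimal {D} ind dom = dom , λ E E⊂D domE →
    let v , v∈D , v∉E = ⊂⁻ E⊂D in
    case domE v of λ where
      (inj₁ v∈E)            → v∉E v∈E
      (inj₂ (u , u∈E , vu)) → ind v∈D (proj₁ E⊂D u∈E) vu

  -- Greedy extension: an undominated vertex has no neighbour in `S`, so adding it preserves
  -- independence; when none is left, the set dominates.
  extendIndependent : ∀ {S} → Independent S →
    ∃[ M ] ((∀ {v} → v ∈ S → v ∈ M) × Independent M × Dominating M)
  extendIndependent {S} = go S (⊃-wellFounded S)
    where
    go : ∀ S → Acc (λ D E → E ⊂ D) S → Independent S →
      ∃[ M ] ((∀ {v} → v ∈ S → v ∈ M) × Independent M × Dominating M)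
    go S (acc rec) ind with any? (λ v → ¬? (dominated? S v))
    ... | no ∄ = S , id , ind , λ v → decidable-stable (dominated? S v) (λ ¬dom → ∄ (v , ¬dom))
    ... | yes (v , ¬dom) =
      let M , S⁺⊆M , rest = go S⁺ (rec (⊂⁺ (∈⁺ ∘ inj₂) (∈⁺ (inj₁ refl)) (¬dom ∘ inj₁))) ind⁺
      in M , S⁺⊆M ∘ ∈⁺ ∘ inj₂ , rest
      where
      ∈S⁺? : Decidable λ u → u ≡ v ⊎ u ∈ S
      ∈S⁺? u = (u ≟ v) ⊎-dec (u ∈? S)

      S⁺ : VSet
      S⁺ = ⟦ ∈S⁺? ⟧

      ∈⁺ : ∀ {u} → u ≡ v ⊎ u ∈ S → u ∈ S⁺
      ∈⁺ = ∈⟦⟧⁺ ∈S⁺?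

      ind⁺ : Independent S⁺
      ind⁺ x∈ y∈ xy with ∈⟦⟧⁻ ∈S⁺? x∈ | ∈⟦⟧⁻ ∈S⁺? y∈
      ... | inj₁ refl | inj₁ refl = loopless refl xy
      ... | inj₁ refl | inj₂ y∈S  = ¬dom (inj₂ (_ , y∈S , xy))
      ... | inj₂ x∈S  | inj₁ refl = ¬dom (inj₂ (_ , x∈S , symmetric xy))
      ... | inj₂ x∈S  | inj₂ y∈S  = ind x∈S y∈S xy

  -- With `u` and `v` equal, this also covers singletons.
  pair-independent : ∀ {u v} → ¬ Adj u v → Independent (setOf (u ∷ v ∷ []))
  pair-independent ¬uv x∈ y∈ xy with ∈-setOf⁻ x∈ | ∈-setOf⁻ y∈
  ... | here refl         | here refl         = loopless refl xy
  ... | here refl         | there (here refl) = ¬uv xy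
  ... | there (here refl) | here refl         = ¬uv (symmetric xy)
  ... | there (here refl) | there (here refl) = loopless refl xy

  -- Nonadjacent pairs, induced paths and total domination.

  complete-or-nonadjacent : Complete G ⊎ (∃₂ λ u v → u ≢ v × ¬ Adj u v)
  complete-or-nonadjacent with any? (λ u → any? (λ v → ¬? (u ≟ v) ×-dec ¬? (Adj? u v)))
  ... | yes (u , v , p) = inj₂ (u , v , p)
  ... | no ∄ = inj₁ λ {u} {v} u≢v → decidable-stable (Adj? u v) λ ¬uv → ∄ (u , v , u≢v , ¬uv)

  distinctVertices : Nontrivial G → ∃₂ λ (u v : V) → u ≢ v
  distinctVertices 2≤ with i , j , i≢j ← distinctIndices 2≤ =
    vertex i , vertex j , i≢j ∘ vertex-injective

  neighbour : Nontrivial G → Connected G → ∀ v → ∃[ u ] Adj v u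
  neighbour 2≤ conn v = let p , q , p≢q = distinctVertices 2≤ in case v ≟ p of λ where
      (no v≢p)   → firstStep v≢p (conn v p)
      (yes refl) → firstStep p≢q (conn p q)
    where
    firstStep : ∀ {u w} → u ≢ w → Star Adj u w → ∃[ t ] Adj u t
    firstStep u≢w ε        = contradiction refl u≢w
    firstStep u≢w (ut ◅ _) = _ , ut

  -- Follow the walk towards the fixed end `v` until the next vertex is adjacent to `v`; the current
  -- vertex, the next one and `v` then form the path.
  inducedPath : ∀ {u v} → Star Adj u v → u ≢ v → ¬ Adj u v →
    ∃[ x ] ∃[ y ] ∃[ z ] (x ≢ z × ¬ Adj x z × Adj x y × Adj z y)
  inducedPath ε u≢v ¬uv = contradiction refl u≢v
  inducedPath {u} {v} (_◅_ {j = w} uw w⋆v) u≢v ¬uv with Adj? w v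
  ... | yes wv = u , w , v , u≢v , ¬uv , uw , symmetric wv
  -- `w` differs from `v`, since `u` is adjacent to `w` but not to `v`.
  ... | no ¬wv = inducedPath w⋆v (λ { refl → ¬uv uw }) ¬wv

  -- Vertices outside `B` have a neighbour in `B`; members of `B` get a chosen neighbour. As `x` and
  -- `z` share `y`, one choice is saved, which makes the bound strict.
  totallyDominatingList : (∀ v → ∃[ u ] Adj v u) → ∀ {B x y z} → Dominating B →
    x ∈ B → z ∈ B → x ≢ z → Adj x y → Adj z y →
    ∃[ ts ] (length ts < 2 * ∣ B ∣ × (∀ v → ∃[ t ] (t ∈ˡ ts × Adj v t)))
  totallyDominatingList nbr {B} {x} {y} {z} dom x∈B z∈B x≢z xy zy =
    bs ++ map (proj₁ ∘ choose) cs , length< , λ v → case dom v of λ where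
      (inj₂ (u , u∈B , vu)) → u , ∈-++⁺ˡ (∈-elements⁺ u∈B) , vu
      (inj₁ v∈B)            → member-neighbour v∈B
    where
    -- The choice is `y` whenever possible, so that the neighbour chosen for `x` is known to be `y`.
    choose : ∀ v → ∃[ u ] (Adj v u × (Adj v y → u ≡ y))
    choose v with Adj? v y
    ... | yes vy = y , vy , λ _ → refl
    ... | no ¬vy = let u , vu = nbr v in u , vu , λ vy → contradiction vy ¬vy

    bs cs : List V
    bs = elements B
    -- No choice is made for `z`: the one made for `x` serves it.
    cs = filter (λ v → ¬? (z ≟ v)) bs

    chosen : ∀ {v} → v ∈ B → z ≢ v → proj₁ (choose v) ∈ˡ bs ++ map (proj₁ ∘ choose) cs
    chosen v∈B z≢v = ∈-++⁺ʳ bs (∈-map⁺ _ (∈-filter⁺ _ (∈-elements⁺ v∈B) z≢v))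

    member-neighbour : ∀ {v} → v ∈ B → ∃[ t ] (t ∈ˡ bs ++ map (proj₁ ∘ choose) cs × Adj v t)
    member-neighbour {v} v∈B with z ≟ v
    ... | no z≢v   = proj₁ (choose v) , chosen v∈B z≢v , proj₁ (proj₂ (choose v))
    ... | yes refl = proj₁ (choose x) , chosen x∈B (x≢z ∘ sym) ,
      subst (Adj z) (sym (proj₂ (proj₂ (choose x)) xy)) zy

    length< : length (bs ++ map (proj₁ ∘ choose) cs) < 2 * ∣ B ∣
    length< = begin-strict
      length (bs ++ map (proj₁ ∘ choose) cs)         ≡⟨ length-++ bs ⟩
      length bs + length (map (proj₁ ∘ choose) cs)   ≡⟨ cong (length bs +_) (length-map _ cs) ⟩
      length bs + length cs                          <⟨ +-monoʳ-< (length bs) (filter-notAll _ bs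
                                                          (Any.map (λ z≡v z≢v → z≢v z≡v) (∈-elements⁺ z∈B))) ⟩
      length bs + length bs                          ≡⟨ cong (λ k → k + k) (length-elements B) ⟩
      ∣ B ∣ + ∣ B ∣                                  ≡⟨ cong (∣ B ∣ +_) (+-identityʳ ∣ B ∣) ⟨
      2 * ∣ B ∣                                      ∎
      where open ≤-Reasoning

  -- A minimum dominating set contains a minimal one, whose size can only be `γ G`; well-domination
  -- spreads this size to all others.
  wellDominated⇒∣∣≡γ : WellDominated G → ∀ {D} → MinimalDominating D → ∣ D ∣ ≡ γ G
  wellDominated⇒∣∣≡γ wd {D} minD with (D₀ , dom , ∣D₀∣≡γ) , γ≤ ← γ-isMinimum G
    with M , M⊆D₀ , minM ← minimal⊆ dom =
    trans (wd D M minD minM) (≤-antisym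
      (subst (∣ M ∣ ≤_) ∣D₀∣≡γ (⊆⇒∣∣≤ M⊆D₀))
      (γ≤ ∣ M ∣ (M , proj₁ minM , refl)))

-- Transport of minimal dominating sets along embeddings.

-- Domination is pushed forward by `dominating` and pulled back by `reflects`, so minimal dominating
-- sets of `G` match those of `K` lying in the range. Allowing any `E` that contains the images
-- makes `dominating` independent of how images are encoded.
record DominatingEmbedding (G K : Graph) : Set where
  private
    module G = Vertices G
    module K = Vertices K
  field
    to         : G.V → K.V
    injective  : ∀ {u v} → to u ≡ to v → u ≡ v
    reflects   : ∀ {u v} → K.Adj (to u) (to v) → G.Adj u v
    dominating : ∀ {D E} → (∀ {v} → v G.∈ D → to v K.∈ E) → G.Dominating D → K.Dominating E

  image : G.VSet → K.VSet
  image D = K.setOf (map to (G.elements D))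

  ∈-image⁺ : ∀ {D v} → v G.∈ D → to v K.∈ image D
  ∈-image⁺ v∈D = K.∈-setOf⁺ (∈-map⁺ to (G.∈-elements⁺ v∈D))

  ∈-image⁻ : ∀ {D w} → w K.∈ image D → ∃[ v ] (v G.∈ D × w ≡ to v)
  ∈-image⁻ w∈ with v , v∈ , eq ← ∈-map⁻ to (K.∈-setOf⁻ w∈) = v , G.∈-elements⁻ v∈ , eq

  ∣image∣ : ∀ D → ∣ image D ∣ ≡ ∣ D ∣
  ∣image∣ D = trans (K.∣setOf∣≡length (Unique.map⁺ injective (G.elements-unique D)))
    (trans (length-map to (G.elements D)) (G.length-elements D))

  preimage : K.VSet → G.VSet
  preimage E = G.⟦ (λ v → to v K.∈? E) ⟧

  ∈-preimage⁺ : ∀ {E v} → to v K.∈ E → v G.∈ preimage E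
  ∈-preimage⁺ {E} = G.∈⟦⟧⁺ (λ v → to v K.∈? E)

  ∈-preimage⁻ : ∀ {E v} → v G.∈ preimage E → to v K.∈ E
  ∈-preimage⁻ {E} = G.∈⟦⟧⁻ (λ v → to v K.∈? E)

  InRange : K.VSet → Set
  InRange E = ∀ {w} → w K.∈ E → ∃[ v ] w ≡ to v

  preimage-dominating : ∀ {E} → InRange E → K.Dominating E → G.Dominating (preimage E)
  preimage-dominating ran dom v with dom (to v)
  ... | inj₁ v∈E = inj₁ (∈-preimage⁺ v∈E)
  ... | inj₂ (w , w∈E , vw) with u , refl ← ran w∈E = inj₂ (u , ∈-preimage⁺ w∈E , reflects vw)

  -- A dominating set strictly inside the image would pull back to one strictly inside `D`.
  image-minimal : ∀ {D} → G.MinimalDominating D → K.MinimalDominating (image D)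
  image-minimal {D} (dom , min) = dominating ∈-image⁺ dom , λ E E⊂ domE →
    let ran : ∀ {w} → w K.∈ E → ∃[ v ] (v G.∈ D × w ≡ to v)
        ran w∈E = ∈-image⁻ (proj₁ E⊂ w∈E)
        w , w∈ , w∉E = K.⊂⁻ E⊂
        v , v∈D , w≡ = ∈-image⁻ w∈
        E′⊆D : ∀ {u} → u G.∈ preimage E → u G.∈ D
        E′⊆D u∈ = let _ , u′∈D , eq = ran (∈-preimage⁻ u∈) in
          subst (G._∈ D) (sym (injective eq)) u′∈D
    in min (preimage E)
      (G.⊂⁺ E′⊆D v∈D (λ v∈ → w∉E (subst (K._∈ E) (sym w≡) (∈-preimage⁻ v∈))))
      (preimage-dominating (λ w∈E → let v , _ , eq = ran w∈E in v , eq) domE)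

  -- A dominating set strictly inside the preimage would push forward to one strictly inside `E`.
  preimage-minimal : ∀ {E} → InRange E → K.MinimalDominating E → G.MinimalDominating (preimage E)
  preimage-minimal {E} ran (dom , min) = preimage-dominating ran dom , λ D D⊂ domD →
    let v , v∈ , v∉D = G.⊂⁻ D⊂
        image⊆E : ∀ {w} → w K.∈ image D → w K.∈ E
        image⊆E w∈ = let u , u∈D , eq = ∈-image⁻ w∈ in
          subst (K._∈ E) (sym eq) (∈-preimage⁻ (proj₁ D⊂ u∈D))
        v∉image : ¬ to v K.∈ image D
        v∉image v∈i = let u , u∈D , eq = ∈-image⁻ v∈i in v∉D (subst (G._∈ D) (sym (injective eq)) u∈D)
    in min (image D) (K.⊂⁺ image⊆E (∈-preimage⁻ v∈) v∉image) (dominating ∈-image⁺ domD)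

  ∣preimage∣ : ∀ {E} → InRange E → ∣ preimage E ∣ ≡ ∣ E ∣
  ∣preimage∣ {E} ran = trans (sym (∣image∣ (preimage E))) (≤-antisym
    (K.⊆⇒∣∣≤ λ w∈ → let _ , v∈ , eq = ∈-image⁻ w∈ in subst (K._∈ E) (sym eq) (∈-preimage⁻ v∈))
    (K.⊆⇒∣∣≤ λ w∈E → let v , eq = ran w∈E in
      subst (K._∈ image (preimage E)) (sym eq) (∈-image⁺ (∈-preimage⁺ (subst (K._∈ E) eq w∈E)))))

  wellDominated : WellDominated K → WellDominated G
  wellDominated wd D D′ min min′ = trans (sym (∣image∣ D))
    (trans (wd (image D) (image D′) (image-minimal min) (image-minimal min′)) (∣image∣ D′))

∨-swap : ∀ G H → DominatingEmbedding (G ∨ H) (H ∨ G)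
∨-swap G H = record
  { to         = swap
  ; injective  = λ { refl → refl }
  ; reflects   = Sum.swap
  ; dominating = λ D⊆E dom (h , g) →
      Sum.map D⊆E (λ (u , u∈D , vu) → swap u , D⊆E u∈D , Sum.swap vu) (dom (g , h))
  }

-- The disjunctive product with a complete factor.

module Product (G H : Graph) where
  private
    module G = Vertices G
    module H = Vertices H
    module P = Vertices (G ∨ H)

  -- Inside the row of `g`, adjacency is that of `H`; a vertex of another row is adjacent to the
  -- whole row of `g`.
  row : Complete G → G.V → DominatingEmbedding H (G ∨ H)
  row complete g = record
    { to         = g ,_
    ; injective  = λ { refl → refl }
    ; reflects   = λ where
        (inj₁ gg) → contradiction gg (G.loopless refl)
        (inj₂ uv) → uv
    ; dominating = dominating
    }
    where
    dominating : ∀ {D E} → (∀ {v} → v H.∈ D → (g , v) P.∈ E) → H.Dominating D → P.Dominating E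
    dominating D⊆E dom (x , y) with x G.≟ g
    ... | yes refl = Sum.map D⊆E (λ (u , u∈D , yu) → (g , u) , D⊆E u∈D , inj₂ yu) (dom y)
    ... | no x≢g   = let d , d∈D = H.member y dom in inj₂ ((g , d) , D⊆E d∈D , inj₁ (complete x≢g))

  -- Every `x` differs from `g` or from `g′`, so it is adjacent to one of them.
  pair-dominating : Complete G → ∀ {g g′ h h′} → g ≢ g′ →
    P.Dominating (P.setOf ((g , h) ∷ (g′ , h′) ∷ []))
  pair-dominating complete {g} {g′} g≢g′ (x , y) with x G.≟ g
  ... | no x≢g   = inj₂ (_ , P.∈-setOf⁺ (here refl) , inj₁ (complete x≢g))
  ... | yes refl = inj₂ (_ , P.∈-setOf⁺ (there (here refl)) , inj₁ (complete g≢g′))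

  -- A row carries well-domination to `H`. The bound compares a minimal dominating set of a row with
  -- one found inside a pair from two rows.
  factor-wellDominated : Complete G → Nontrivial G → Nontrivial H →
    WellDominated (G ∨ H) → WellDominated H × γ H ≤ 2
  factor-wellDominated complete ntG ntH wd
    with g , g′ , g≢g′ ← G.distinctVertices ntG
    with h , _ ← H.distinctVertices ntH
    with M , M⊆pair , minM ← P.minimal⊆ (pair-dominating complete {h = h} {h′ = h} g≢g′)
    with D , _ , minD ← H.minimal⊆ {D = ⊤} (λ _ → inj₁ ∈⊤) =
    wdH , γ≤2
    where
    open DominatingEmbedding (row complete g)

    wdH : WellDominated H
    wdH = wellDominated wd

    γ≤2 : γ H ≤ 2
    γ≤2 = begin
      γ H         ≡⟨ H.wellDominated⇒∣∣≡γ wdH minD ⟨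
      ∣ D ∣       ≡⟨ ∣image∣ D ⟨
      ∣ image D ∣ ≡⟨ wd (image D) M (image-minimal minD) minM ⟩
      ∣ M ∣       ≤⟨ P.∣∣≤length (P.∈-setOf⁻ ∘ M⊆pair) ⟩
      2           ∎
      where open ≤-Reasoning

  product-wellDominated : Complete G → Nontrivial G → Nontrivial H →
    WellDominated H → γ H ≤ 2 → WellDominated (G ∨ H)
  product-wellDominated complete ntG ntH wd γ≤2 E E′ min min′ =
    trans (∣∣≡γ min) (sym (∣∣≡γ min′))
    where
    ∣∣≡γ : ∀ {E} → P.MinimalDominating E → ∣ E ∣ ≡ γ H
    ∣∣≡γ {E} (dom , min)
      with (g , h) , gh∈E ← P.member (proj₁ (G.distinctVertices ntG) , proj₁ (H.distinctVertices ntH)) dom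
      with P.any? (λ v → (v P.∈? E) ×-dec ¬? (proj₁ v G.≟ g))
    -- All of `E` lies in the row of `g`, so it is a minimal dominating set of `H` in disguise.
    ... | no ∄ = trans (sym (∣preimage∣ ran)) (H.wellDominated⇒∣∣≡γ wd (preimage-minimal ran (dom , min)))
      where
      open DominatingEmbedding (row complete g)

      ran : InRange E
      ran {x , y} v∈E = y , cong (_, y) (decidable-stable (x G.≟ g) λ x≢g → ∄ ((x , y) , v∈E , x≢g))
    -- `E` meets two rows: it is then exactly a pair, and `γ H` must be 2.
    ... | yes ((g′ , h′) , g′h′∈E , g′≢g) = trans
      (≤-antisym (P.∣∣≤length E⊆pair) (P.distinct⇒2≤∣∣ (g′≢g ∘ sym ∘ cong proj₁) gh∈E g′h′∈E))
      (≤-antisym 2≤γ γ≤2)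
      where
      open DominatingEmbedding (row complete g)

      pair : List P.V
      pair = (g , h) ∷ (g′ , h′) ∷ []

      pair⊆E : ∀ {v} → v P.∈ P.setOf pair → v P.∈ E
      pair⊆E v∈ with P.∈-setOf⁻ v∈
      ... | here refl         = gh∈E
      ... | there (here refl) = g′h′∈E

      E⊆pair : ∀ {v} → v P.∈ E → v ∈ˡ pair
      -- The pair already dominates, so any further vertex would contradict the minimality of `E`.
      E⊆pair {v} v∈E = decidable-stable (v P.∈ˡ? pair) λ v∉ →
        min (P.setOf pair) (P.⊂⁺ pair⊆E v∈E (v∉ ∘ P.∈-setOf⁻)) (pair-dominating complete (g′≢g ∘ sym))

      -- If γ H were 1, then h would dominate H and (g , h) would dominate G ∨ H.
      2≤γ : 2 ≤ γ H
      2≤γ = decidable-stable (2 ≤? γ H) λ 2≰γ →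
        let M , ⊆M , indM , domM = H.extendIndependent (H.pair-independent {h} {h} (H.loopless refl))
            ∣M∣≡γ = H.wellDominated⇒∣∣≡γ wd (H.independent⇒minimal indM domM)
            h∈M = ⊆M (H.∈-setOf⁺ (here refl))
            M≡h : ∀ {u} → u H.∈ M → u ≡ h
            M≡h {u} u∈M = decidable-stable (u H.≟ h) λ u≢h →
              2≰γ (subst (2 ≤_) ∣M∣≡γ (H.distinct⇒2≤∣∣ u≢h u∈M h∈M))
        in min (P.setOf [ g , h ])
          (P.⊂⁺ (λ v∈ → case P.∈-setOf⁻ v∈ of λ { (here refl) → gh∈E })
            g′h′∈E (λ v∈ → case P.∈-setOf⁻ v∈ of λ { (here refl) → g′≢g refl }))
          (dominating (λ u∈M → P.∈-setOf⁺ (here (cong (g ,_) (M≡h u∈M)))) domM)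

  -- The disjunctive product with no complete factor.

  module _ {A B} (indA : G.Independent A) (domA : G.Dominating A)
                 (indB : H.Independent B) (domB : H.Dominating B) where

    private
      pairs : List P.V
      pairs = cartesianProduct (G.elements A) (H.elements B)

      ∈⁺ : ∀ {a b} → a G.∈ A → b H.∈ B → (a , b) P.∈ P.setOf pairs
      ∈⁺ a∈A b∈B = P.∈-setOf⁺ (∈-cartesianProduct⁺ (G.∈-elements⁺ a∈A) (H.∈-elements⁺ b∈B))

      ∈⁻ : ∀ {v} → v P.∈ P.setOf pairs → proj₁ v G.∈ A × proj₂ v H.∈ B
      ∈⁻ v∈ with a∈ , b∈ ← ∈-cartesianProduct⁻ (G.elements A) (H.elements B) (P.∈-setOf⁻ v∈) =
        G.∈-elements⁻ a∈ , H.∈-elements⁻ b∈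

      independent : P.Independent (P.setOf pairs)
      independent u∈ v∈ (inj₁ gg) = indA (proj₁ (∈⁻ u∈)) (proj₁ (∈⁻ v∈)) gg
      independent u∈ v∈ (inj₂ hh) = indB (proj₂ (∈⁻ u∈)) (proj₂ (∈⁻ v∈)) hh

      dominating : P.Dominating (P.setOf pairs)
      dominating (x , y) with domA x | domB y
      ... | inj₁ x∈A            | inj₁ y∈B            = inj₁ (∈⁺ x∈A y∈B)
      ... | inj₁ x∈A            | inj₂ (w , w∈B , yw) = inj₂ (_ , ∈⁺ x∈A w∈B , inj₂ yw)
      -- Adjacency of `x` and `u` suffices, so any member of `B` will do as second coordinate.
      ... | inj₂ (u , u∈A , xu) | _                   =
        inj₂ (_ , ∈⁺ u∈A (proj₂ (H.member y domB)) , inj₁ xu)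

    product-minimal : ∃[ D ] (P.MinimalDominating D × ∣ D ∣ ≡ ∣ A ∣ * ∣ B ∣)
    product-minimal = P.setOf pairs , P.independent⇒minimal independent dominating , (begin
      ∣ P.setOf pairs ∣                               ≡⟨ P.∣setOf∣≡length
                                                           (Unique.cartesianProduct⁺ (G.elements-unique A) (H.elements-unique B)) ⟩
      length pairs                                    ≡⟨ length-cartesianProduct (G.elements A) (H.elements B) ⟩
      length (G.elements A) * length (H.elements B)   ≡⟨ cong₂ _*_ (G.length-elements A) (H.length-elements B) ⟩
      ∣ A ∣ * ∣ B ∣                                   ∎)
      where open ≡-Reasoning

  -- Each vertex is reached through its second coordinate alone. Mere domination of `H` could miss
  -- `(x , y)` with `y` in `ts` and `x` not adjacent to `g`.
  totalRow-dominating : ∀ g {ts} → (∀ v → ∃[ t ] (t ∈ˡ ts × H.Adj v t)) →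
    P.Dominating (P.setOf (map (g ,_) ts))
  totalRow-dominating g total (x , y) with t , t∈ , yt ← total y =
    inj₂ (_ , P.∈-setOf⁺ (∈-map⁺ (g ,_) t∈) , inj₂ yt)

  complete-factor : Nontrivial H → Connected H → WellDominated (G ∨ H) → Complete G ⊎ Complete H
  complete-factor ntH connH wd with G.complete-or-nonadjacent | H.complete-or-nonadjacent
  ... | inj₁ completeG | _ = inj₁ completeG
  ... | inj₂ _         | inj₁ completeH = inj₂ completeH
  ... | inj₂ (g , g′ , g≢g′ , ¬gg′) | inj₂ (u , v , u≢v , ¬uv)
    with x , y , z , x≢z , ¬xz , xy , zy ← H.inducedPath (connH u v) u≢v ¬uv
    with A , ⊆A , indA , domA ← G.extendIndependent (G.pair-independent ¬gg′)
    with B , ⊆B , indB , domB ← H.extendIndependent (H.pair-independent ¬xz)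
    with D , minD , ∣D∣≡ ← product-minimal indA domA indB domB
    with ts , ts< , total ← H.totallyDominatingList (H.neighbour ntH connH) domB
           (⊆B (H.∈-setOf⁺ (here refl))) (⊆B (H.∈-setOf⁺ (there (here refl)))) x≢z xy zy
    with M , M⊆row , minM ← P.minimal⊆ (totalRow-dominating g total) =
    contradiction 2∣B∣≤length (<⇒≱ ts<)
    where
    2∣B∣≤length : 2 * ∣ B ∣ ≤ length ts
    2∣B∣≤length = begin
      -- The factor 2 comes from `g` and `g′`, two distinct members of `A`.
      2 * ∣ B ∣               ≤⟨ *-monoˡ-≤ ∣ B ∣ (G.distinct⇒2≤∣∣ g≢g′
                                   (⊆A (G.∈-setOf⁺ (here refl))) (⊆A (G.∈-setOf⁺ (there (here refl))))) ⟩
      ∣ A ∣ * ∣ B ∣           ≡⟨ ∣D∣≡ ⟨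
      ∣ D ∣                   ≡⟨ wd D M minD minM ⟩
      ∣ M ∣                   ≤⟨ P.∣∣≤length (P.∈-setOf⁻ ∘ M⊆row) ⟩
      length (map (g ,_) ts)  ≡⟨ length-map (g ,_) ts ⟩
      length ts               ∎
      where open ≤-Reasoning

-- The equivalence, by symmetry of the two factors.

theorem4 : (G H : Graph) → Nontrivial G → Connected G → Nontrivial H → Connected H →
    WellDominated (G ∨ H) ⇔
    ((Complete G × WellDominated H × γ H ≤ 2) ⊎ (Complete H × WellDominated G × γ G ≤ 2))
theorem4 G H ntG _ ntH connH = mk⇔ forward backward
  where
  forward : WellDominated (G ∨ H) →
    (Complete G × WellDominated H × γ H ≤ 2) ⊎ (Complete H × WellDominated G × γ G ≤ 2)
  forward wd with Product.complete-factor G H ntH connH wd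
  ... | inj₁ completeG = inj₁ (completeG , Product.factor-wellDominated G H completeG ntG ntH wd)
  -- Well-domination is pulled back along an embedding, so `H ∨ G` inherits it from `G ∨ H`.
  ... | inj₂ completeH = inj₂ (completeH , Product.factor-wellDominated H G completeH ntH ntG
    (DominatingEmbedding.wellDominated (∨-swap H G) wd))

  backward : (Complete G × WellDominated H × γ H ≤ 2) ⊎ (Complete H × WellDominated G × γ G ≤ 2) →
    WellDominated (G ∨ H)
  backward (inj₁ (completeG , wd , γ≤2)) = Product.product-wellDominated G H completeG ntG ntH wd γ≤2
  backward (inj₂ (completeH , wd , γ≤2)) = DominatingEmbedding.wellDominated (∨-swap G H)
    (Product.product-wellDominated H G completeH ntH ntG wd γ≤2)
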